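{- Let $H$ be a graph and suppose that the class of $\{2K_2,H\}$-free graphs admits the $\chi$-binding function $f$, i.e. $\chi(G')\leq f(\omega(G'))$ for every $\{2K_2,H\}$-free graph $G'$. Then every connected $\{\text{butterfly},\text{hammer},H\}$-free graph $G$ with $\omega(G)\neq 2$ satisfies $\chi(G)\leq f(\omega(G))+3$.
   Context: All graphs are simple, finite and undirected. $\omega(G)$ is the clique number and $\chi(G)$ the chromatic number of $G$. For a family $\mathcal{F}$ of graphs, $G$ is $\mathcal{F}$-free if it has no induced subgraph isomorphic to a member of $\mathcal{F}$. The butterfly is the graph on five vertices consisting of two triangles sharing exactly one vertex (with no other edges). The hammer is the graph on five vertices $a,b,c,d,e$ with edges $ab,bc,ac,cd,de$. $2K_2$ is the disjoint union of two copies of $K_2$. -}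

module Defs where

open import Data.Fin using (Fin; #_; finToFun; funToFin)
open import Data.Fin.Properties using (_≟_; all?; any?; finToFun-funToFin)
open import Data.Fin.Subset using (Subset; _∈_; ∣_∣; ⊥)
open import Data.Fin.Subset.Properties using (_∈?_; ∉⊥; ∣⊥∣≡0; ∣p∣≤n; anySubset?)
open import Data.List.Base using (List; []; _∷_)
open import Data.List.Membership.DecPropositional using () renaming (_∈?_ to member?)
open import Data.List.Membership.Propositional using () renaming (_∈_ to _∈ˡ_)
open import Data.List.Relation.Unary.All using (All)
open import Data.Nat.Base using (ℕ; zero; suc; _^_; _≤_; s≤s; s≤s⁻¹; z≤n)
import Data.Nat.Properties as ℕ
open import Data.Product.Base using (∃; _×_; _,_; proj₁)
open import Data.Product.Properties using (≡-dec)
open import Data.Sum.Base using (_⊎_; swap)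
open import Function.Base using (_∘_; id)
open import Function.Bundles using (_⇔_)
open import Function.Definitions using (Injective)
open import Level using (0ℓ)
open import Relation.Binary.Construct.Closure.ReflexiveTransitive using (Star)
open import Relation.Binary.Core using (Rel)
open import Relation.Binary.Definitions using (Decidable; Irreflexive; Symmetric)
open import Relation.Binary.PropositionalEquality using (_≡_; _≢_; refl; sym; trans; subst)
open import Relation.Nullary.Decidable using (yes; no; map′; ¬?; _×-dec_; _⊎-dec_; _→-dec_)
open import Relation.Nullary.Negation using (¬_; contradiction)
import Relation.Unary as U

record Graph : Set₁ where
  field
    order  : ℕ
    _~_    : Rel (Fin order) 0ℓ
    _~?_   : Decidable _~_
    irrefl : Irreflexive _≡_ _~_
    symm   : Symmetric _~_

  Vertex : Set
  Vertex = Fin order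

open Graph using (order; Vertex)

Adj : (G : Graph) → Rel (Vertex G) 0ℓ
Adj = Graph._~_

-- Each edge is listed once, in either orientation.
fromEdges : (n : ℕ) → List (Fin n × Fin n) → Graph
fromEdges n E = record
  { order  = n
  ; _~_    = λ u v → u ≢ v × ((u , v) ∈ˡ E ⊎ (v , u) ∈ˡ E)
  ; _~?_   = λ u v → ¬? (u ≟ v) ×-dec (mem? (u , v) E ⊎-dec mem? (v , u) E)
  ; irrefl = λ u≡v (u≢v , _) → u≢v u≡v
  ; symm   = λ (u≢v , e) → u≢v ∘ sym , swap e
  }
  where mem? = member? (≡-dec _≟_ _≟_)

2K₂ : Graph
2K₂ = fromEdges 4 ((# 0 , # 1) ∷ (# 2 , # 3) ∷ [])

butterfly : Graph
butterfly = fromEdges 5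
  ( (# 0 , # 1) ∷ (# 0 , # 2) ∷ (# 1 , # 2)
  ∷ (# 0 , # 3) ∷ (# 0 , # 4) ∷ (# 3 , # 4) ∷ [])

hammer : Graph
hammer = fromEdges 5
  ( (# 0 , # 1) ∷ (# 1 , # 2) ∷ (# 0 , # 2)
  ∷ (# 2 , # 3) ∷ (# 3 , # 4) ∷ [])

-- F ⊑ G: the image of φ induces a subgraph of G isomorphic to F.
_⊑_ : Graph → Graph → Set
F ⊑ G = ∃ λ (φ : Vertex F → Vertex G) →
  Injective _≡_ _≡_ φ × (∀ u v → Adj F u v ⇔ Adj G (φ u) (φ v))

_-Free_ : List Graph → Graph → Set₁
ℱ -Free G = All (λ F → ¬ (F ⊑ G)) ℱ

-- The graph without vertices counts as connected.
Connected : Graph → Set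
Connected G = ∀ u v → Star (Adj G) u v

IsGreatest IsLeast : (ℕ → Set) → ℕ → Set
IsGreatest P k = P k × (∀ j → P j → j ≤ k)
IsLeast    P k = P k × (∀ j → P j → k ≤ j)

greatest : ∀ {P} → U.Decidable P → P 0 → ∀ n → (∀ j → P j → j ≤ n) → ∃ (IsGreatest P)
greatest P? P0 zero bound = 0 , P0 , bound
greatest {P} P? P0 (suc n) bound with P? (suc n)
... | yes p = suc n , p , bound
... | no ¬p = greatest P? P0 n λ j pj →
  s≤s⁻¹ (ℕ.≤∧≢⇒< (bound j pj) λ j≡ → ¬p (subst P j≡ pj))

least : ∀ {P} → U.Decidable P → ∀ n → P n → ∃ (IsLeast P)
least P? zero Pn = 0 , Pn , λ _ _ → z≤n
least {P} P? (suc n) Pn with P? 0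
... | yes p = 0 , p , λ _ _ → z≤n
... | no ¬p with least {P ∘ suc} (P? ∘ suc) n Pn
...   | k , pk , min = suc k , pk , λ where
  zero    p0 → contradiction p0 ¬p
  (suc j) pj → s≤s (min j pj)

module _ (G : Graph) where
  open Graph G using (_~_; _~?_; irrefl)

  IsClique : Subset (order G) → Set
  IsClique S = ∀ u v → u ∈ S → v ∈ S → u ≢ v → u ~ v

  HasClique : ℕ → Set
  HasClique k = ∃ λ S → IsClique S × ∣ S ∣ ≡ k

  IsProper : ∀ {k} → (Vertex G → Fin k) → Set
  IsProper c = ∀ u v → u ~ v → c u ≢ c v

  Colorable : ℕ → Set
  Colorable k = ∃ λ (c : Vertex G → Fin k) → IsProper c

  hasClique? : U.Decidable HasClique
  hasClique? k = anySubset? λ S →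
    (all? λ u → all? λ v → (u ∈? S) →-dec ((v ∈? S) →-dec (¬? (u ≟ v) →-dec (u ~? v))))
    ×-dec (∣ S ∣ ℕ.≟ k)

  -- Colourings with k colours are enumerated by Fin (k ^ order G).
  colorable? : U.Decidable Colorable
  colorable? k = map′
    (λ (i , p) → finToFun i , p)
    (λ (c , p) → funToFin c , λ u v u~v eq → p u v u~v
      (trans (sym (finToFun-funToFin c u)) (trans eq (finToFun-funToFin c v))))
    (any? λ (i : Fin (k ^ order G)) →
      all? λ u → all? λ v → (u ~? v) →-dec ¬? (finToFun {k} i u ≟ finToFun i v))

  cliqueNumber : ∃ (IsGreatest HasClique)
  cliqueNumber = greatest hasClique?
    (⊥ , (λ _ _ u∈⊥ → contradiction u∈⊥ ∉⊥) , ∣⊥∣≡0 (order G))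
    (order G) (λ { _ (S , _ , refl) → ∣p∣≤n S })

  chromaticNumber : ∃ (IsLeast Colorable)
  chromaticNumber = least colorable? (order G)
    (id , λ u v u~v u≡v → irrefl u≡v u~v)

  ω χ : ℕ
  ω = proj₁ cliqueNumber
  χ = proj₁ chromaticNumber

{-# OPTIONS --safe #-}

-- Call an edge triangular if it lies in a triangle.  Connectedness forces every
-- edge to meet or to be joined to every triangular edge: otherwise the two edges
-- extend to a butterfly or a hammer, or else the second edge is anticomplete to a
-- whole triangle, and the point where a path from it first attaches to that
-- triangle yields a butterfly or a hammer again.
--
-- If ω G ≥ 3, fix a triangle T inside a maximum clique, and let D be the set of
-- vertices with at least two neighbours in T.  Any two vertices of D share a
-- neighbour in T, so all edges of G[D] are triangular and G[D] is 2K₂-free; it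
-- contains the clique, so ω G[D] = ω G.  A vertex outside D misses both ends of
-- some edge of T, and the vertices missing a given edge are independent, so three
-- further colours suffice.  If ω G ≤ 1, then G itself is 2K₂-free.
module Submission where

open import Defs
open import Data.Bool.Base using (if_then_else_)
import Data.Bool.Properties as Bool
open import Data.Empty using () renaming (⊥ to Empty)
open import Data.Fin using (Fin; zero; suc; join; splitAt) renaming (_<_ to _<ᶠ_)
open import Data.Fin.Patterns using (0F; 1F; 2F; 3F)
open import Data.Fin.Properties using (_≟_; all?; <-cmp; suc-injective; splitAt-join)
open import Data.Fin.Subset using (Subset; inside; outside; ⊥; ⁅_⁆; _∪_; _⊂_; _∈_; _∉_; ∣_∣)
open import Data.Fin.Subset.Properties
  using (∉⊥; q⊆p∪q; x∈p∪q⁺; x∈p∪q⁻; x∈⁅x⁆; x∈⁅y⁆⇒x≡y; p⊂q⇒∣p∣<∣q∣)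
open import Data.List.Base using (List; []; _∷_; allFin; filter; length; lookup; tabulate)
open import Data.List.Membership.Propositional using () renaming (_∈_ to _∈ˡ_)
open import Data.List.Membership.Propositional.Properties
  using (∈-allFin; ∈-filter⁺; ∈-filter⁻; ∈-lookup)
open import Data.List.Properties using (tabulate-lookup)
open import Data.List.Relation.Unary.All using ([]; _∷_)
import Data.List.Relation.Unary.All.Properties as All
open import Data.List.Relation.Unary.AllPairs using (AllPairs; []; _∷_)
import Data.List.Relation.Unary.Any as Any
open import Data.List.Relation.Unary.Any.Properties using (lookup-index)
open import Data.List.Relation.Unary.Unique.Propositional using (Unique)
open import Data.List.Relation.Unary.Unique.Propositional.Properties using (allFin⁺; filter⁺)
open import Data.Nat.Base using (ℕ; zero; suc; _+_; _≤_; z≤n; s≤s; s≤s⁻¹)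
import Data.Nat.Properties as ℕ
open import Data.Product.Base using (∃; _×_; _,_; proj₁; proj₂)
open import Data.Sum.Base using (_⊎_; inj₁; inj₂; [_,_]′)
open import Data.Sum.Properties using (inj₁-injective; inj₂-injective)
open import Data.Vec.Base as Vec using ([]; _∷_; here; there)
open import Function.Base using (_∘_; id; const; flip)
open import Function.Bundles using (_⇔_; mk⇔; Equivalence)
open import Function.Construct.Composition using (_⇔-∘_)
open import Function.Construct.Symmetry using (⇔-sym)
open import Function.Definitions using (Injective)
open import Level using (0ℓ)
open import Relation.Binary.Construct.Closure.ReflexiveTransitive using (Star; ε; _◅_)
open import Relation.Binary.Core using (Rel)
open import Relation.Binary.Definitions using (tri<; tri≈; tri>)
open import Relation.Binary.PropositionalEquality
  using (_≡_; _≢_; refl; sym; trans; cong; subst; subst₂)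
open import Relation.Nullary.Decidable
  using (Dec; yes; no; does; does-⇔; from-yes; from-no; _×-dec_; _⊎-dec_; _→-dec_)
open import Relation.Nullary.Negation using (¬_; contradiction)
import Relation.Unary as U

open Graph using (order; Vertex)
open Equivalence using (to; from)

-- Pairwise relations on lists, read off by position.

AllPairs-tabulate⁻ : ∀ {A : Set} {R : Rel A 0ℓ} {n} {g : Fin n → A} →
  AllPairs R (tabulate g) → ∀ {i j} → i <ᶠ j → R (g i) (g j)
AllPairs-tabulate⁻ (px ∷ _)  {zero}  {suc j} _   = All.tabulate⁻ px j
AllPairs-tabulate⁻ (_ ∷ pxs) {suc i} {suc j} i<j = AllPairs-tabulate⁻ pxs (s≤s⁻¹ i<j)

Unique⇒lookup-injective : ∀ {A : Set} {xs : List A} → Unique xs → Injective _≡_ _≡_ (lookup xs)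
Unique⇒lookup-injective {xs = xs} unique = injective
  where
  distinct : ∀ {i j} → i <ᶠ j → lookup xs i ≢ lookup xs j
  distinct = AllPairs-tabulate⁻ (subst Unique (sym (tabulate-lookup xs)) unique)

  injective : Injective _≡_ _≡_ (lookup xs)
  injective {i} {j} eq with <-cmp i j
  ... | tri< i<j _ _ = contradiction eq (distinct i<j)
  ... | tri≈ _ i≡j _ = i≡j
  ... | tri> _ _ j<i = contradiction (sym eq) (distinct j<i)

-- Induced embeddings, and building them from a table of adjacencies.

⊑-trans : ∀ {F G K} → F ⊑ G → G ⊑ K → F ⊑ K
⊑-trans (φ , φ-inj , φ⇔) (ψ , ψ-inj , ψ⇔) =
  ψ ∘ φ , φ-inj ∘ ψ-inj , λ u v → ψ⇔ (φ u) (φ v) ⇔-∘ φ⇔ u v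

-- For such an `F`, any map that preserves and reflects adjacency is injective, so the vertices of a
-- forbidden pattern never have to be shown distinct one by one.
TwinFree : Graph → Set
TwinFree F = ∀ u v → (∀ w → does (u ~? w) ≡ does (v ~? w)) → u ≡ v
  where open Graph F using (_~?_)

twinFree? : ∀ F → Dec (TwinFree F)
twinFree? F = all? λ u → all? λ v →
  (all? λ w → does (u ~? w) Bool.≟ does (v ~? w)) →-dec (u ≟ v)
  where open Graph F using (_~?_)

module _ (F G : Graph) (φ : Vertex F → Vertex G) where
  private
    module F = Graph F
    module G = Graph G

  -- Branching on `does` lets this compute for a concrete `F`: a proof of `AllPairs Agree` is then
  -- the plain list of edges and non-edges above the diagonal, row by row.
  Agree : Rel (Vertex F) 0ℓ
  Agree u v = if does (u F.~? v) then φ u G.~ φ v else ¬ (φ u G.~ φ v)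

  Agree⇒⇔ : ∀ {u v} → Agree u v → u F.~ v ⇔ φ u G.~ φ v
  Agree⇒⇔ {u} {v} ag with u F.~? v
  ... | yes u~v = mk⇔ (const ag) (const u~v)
  ... | no u≁v  = mk⇔ (flip contradiction u≁v) (flip contradiction ag)

  ⊑-fromAgree : TwinFree F → AllPairs Agree (allFin (order F)) → F ⊑ G
  ⊑-fromAgree twinFree agree = φ , injective , pres
    where
    agree< : ∀ {u v} → u <ᶠ v → Agree u v
    agree< = AllPairs-tabulate⁻ agree

    pres : ∀ u v → u F.~ v ⇔ φ u G.~ φ v
    pres u v with <-cmp u v
    ... | tri< u<v _ _  = Agree⇒⇔ (agree< u<v)
    ... | tri≈ _ refl _ = mk⇔ (flip contradiction (F.irrefl refl)) (flip contradiction (G.irrefl refl))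
    ... | tri> _ _ v<u  = mk⇔ (G.symm ∘ to (Agree⇒⇔ (agree< v<u)) ∘ F.symm)
                              (F.symm ∘ from (Agree⇒⇔ (agree< v<u)) ∘ G.symm)

    injective : Injective _≡_ _≡_ φ
    -- Vertices with equal images have the same neighbours in `F`, because their images have the
    -- same neighbours in `G`.
    injective {u} {v} φu≡φv = twinFree u v λ w → does-⇔
      (⇔-sym (pres v w) ⇔-∘ subst (λ x → u F.~ w ⇔ x G.~ φ w) φu≡φv (pres u w))
      (u F.~? w) (v F.~? w)

-- Cliques as subsets and as indexed families.

enumerate : ∀ {n} (S : Subset n) → Fin ∣ S ∣ → Fin n
enumerate (inside  ∷ S) zero    = zero
enumerate (inside  ∷ S) (suc i) = suc (enumerate S i)
enumerate (outside ∷ S) i       = suc (enumerate S i)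

enumerate-∈ : ∀ {n} (S : Subset n) i → enumerate S i ∈ S
enumerate-∈ (inside  ∷ S) zero    = here
enumerate-∈ (inside  ∷ S) (suc i) = there (enumerate-∈ S i)
enumerate-∈ (outside ∷ S) i       = there (enumerate-∈ S i)

enumerate-injective : ∀ {n} (S : Subset n) → Injective _≡_ _≡_ (enumerate S)
enumerate-injective (inside  ∷ S) {zero}  {zero}  _  = refl
enumerate-injective (inside  ∷ S) {suc i} {suc j} eq =
  cong suc (enumerate-injective S (suc-injective eq))
enumerate-injective (outside ∷ S) eq = enumerate-injective S (suc-injective eq)

image : ∀ {k n} → (Fin k → Fin n) → Subset n
image {zero}  e = ⊥
image {suc k} e = ⁅ e zero ⁆ ∪ image (e ∘ suc)

∈-image⁻ : ∀ {k n} (e : Fin k → Fin n) {x} → x ∈ image e → ∃ λ i → x ≡ e i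
∈-image⁻ {zero}  e x∈ = contradiction x∈ ∉⊥
∈-image⁻ {suc k} e x∈ with x∈p∪q⁻ ⁅ e zero ⁆ (image (e ∘ suc)) x∈
... | inj₁ x∈ˡ = zero , x∈⁅y⁆⇒x≡y _ x∈ˡ
... | inj₂ x∈ʳ = let i , x≡ = ∈-image⁻ (e ∘ suc) x∈ʳ in suc i , x≡

k≤∣image∣ : ∀ {k n} (e : Fin k → Fin n) → Injective _≡_ _≡_ e → k ≤ ∣ image e ∣
k≤∣image∣ {zero}  e inj = z≤n
k≤∣image∣ {suc k} e inj =
  ℕ.≤-trans (s≤s (k≤∣image∣ (e ∘ suc) (suc-injective ∘ inj))) (p⊂q⇒∣p∣<∣q∣ grows)
  where
  new : e zero ∉ image (e ∘ suc)
  new e0∈ with ∈-image⁻ (e ∘ suc) e0∈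
  ... | i , e0≡ with () ← inj e0≡

  grows : image (e ∘ suc) ⊂ image e
  grows = q⊆p∪q ⁅ e zero ⁆ _ , e zero , x∈p∪q⁺ (inj₁ (x∈⁅x⁆ (e zero))) , new

module _ (G : Graph) where
  open Graph G using (_~_; irrefl; symm)

  -- Indexing by `Fin k` instead of using a subset lets cliques travel along maps by composition;
  -- injectivity of `e` comes for free from irreflexivity.
  Clique : ℕ → Set
  Clique k = ∃ λ (e : Fin k → Vertex G) → ∀ {i j} → i ≢ j → e i ~ e j

  Clique⇒≤ω : ∀ {k} → Clique k → k ≤ ω G
  Clique⇒≤ω (e , adj) = ℕ.≤-trans (k≤∣image∣ e injective)
    (proj₂ (proj₂ (cliqueNumber G)) _ (image e , clique , refl))
    where
    injective : Injective _≡_ _≡_ e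
    injective {i} {j} eq with i ≟ j
    ... | yes i≡j = i≡j
    ... | no i≢j  = contradiction (adj i≢j) (irrefl eq)

    clique : IsClique G (image e)
    clique u v u∈ v∈ u≢v with ∈-image⁻ e u∈ | ∈-image⁻ e v∈
    ... | i , refl | j , refl = adj (u≢v ∘ cong e)

  HasClique⇒Clique : ∀ {k} → HasClique G k → Clique k
  HasClique⇒Clique (S , clique , refl) =
    enumerate S , λ i≢j → clique _ _ (enumerate-∈ S _) (enumerate-∈ S _) (i≢j ∘ enumerate-injective S)

  ω-Clique : Clique (ω G)
  ω-Clique = HasClique⇒Clique (proj₁ (proj₂ (cliqueNumber G)))

  edge⇒2≤ω : ∀ {u v} → u ~ v → 2 ≤ ω G
  edge⇒2≤ω {u} {v} u~v = Clique⇒≤ω (e , λ {i} {j} → adj i j)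
    where
    e : Fin 2 → Vertex G
    e = Vec.lookup (u ∷ v ∷ [])

    adj : ∀ i j → i ≢ j → e i ~ e j
    adj 0F 0F i≢j = contradiction refl i≢j
    adj 0F 1F _   = u~v
    adj 1F 0F _   = symm u~v
    adj 1F 1F i≢j = contradiction refl i≢j

  2K₂-vertices : 2K₂ ⊑ G → ∃ λ x → ∃ λ y → ∃ λ u → ∃ λ v →
    x ~ y × u ~ v × ¬ x ~ u × ¬ x ~ v × ¬ y ~ u × ¬ y ~ v
  2K₂-vertices (φ , _ , φ⇔) =
      φ 0F , φ 1F , φ 2F , φ 3F
    , to (φ⇔ _ _) (from-yes (0F ~₀? 1F)) , to (φ⇔ _ _) (from-yes (2F ~₀? 3F))
    , from-no (0F ~₀? 2F) ∘ from (φ⇔ _ _) , from-no (0F ~₀? 3F) ∘ from (φ⇔ _ _)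
    , from-no (1F ~₀? 2F) ∘ from (φ⇔ _ _) , from-no (1F ~₀? 3F) ∘ from (φ⇔ _ _)
    where open Graph 2K₂ using () renaming (_~?_ to _~₀?_)

-- Induced subgraphs: clique number and extension of colourings.

module Induced (G : Graph) {D : U.Pred (Vertex G) 0ℓ} (D? : U.Decidable D) where
  open Graph G using (_~_; _~?_; irrefl; symm)

  members : List (Vertex G)
  members = filter D? (allFin (order G))

  ι : Fin (length members) → Vertex G
  ι = lookup members

  ι-injective : Injective _≡_ _≡_ ι
  ι-injective = Unique⇒lookup-injective (filter⁺ D? (allFin⁺ (order G)))

  ι-∈ : ∀ i → D (ι i)
  ι-∈ i = proj₂ (∈-filter⁻ D? {xs = allFin (order G)} (∈-lookup i))

  member : ∀ {v} → D v → v ∈ˡ members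
  member {v} d = ∈-filter⁺ D? (∈-allFin v) d

  ι⁻¹ : ∀ {v} → D v → Fin (length members)
  ι⁻¹ d = Any.index (member d)

  ι-ι⁻¹ : ∀ {v} (d : D v) → v ≡ ι (ι⁻¹ d)
  ι-ι⁻¹ d = lookup-index (member d)

  G[D] : Graph
  G[D] = record
    { order  = length members
    ; _~_    = λ i j → ι i ~ ι j
    ; _~?_   = λ i j → ι i ~? ι j
    ; irrefl = λ i≡j → irrefl (cong ι i≡j)
    ; symm   = symm
    }

  G[D]⊑G : G[D] ⊑ G
  G[D]⊑G = ι , ι-injective , λ _ _ → mk⇔ id id

  ι⁻¹-adj : ∀ {u v} (p : D u) (q : D v) → u ~ v → Adj G[D] (ι⁻¹ p) (ι⁻¹ q)
  ι⁻¹-adj p q = subst₂ _~_ (ι-ι⁻¹ p) (ι-ι⁻¹ q)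

  -- Cliques of `G[D]` map into `G` under `ι`; conversely `K` survives in `G[D]`, and `ω G ≤ k`
  -- makes it a maximum clique.
  ωG[D]≡ωG : ∀ {k} → ω G ≤ k → (K : Clique G k) → (∀ i → D (proj₁ K i)) → ω G[D] ≡ ω G
  ωG[D]≡ωG ωG≤k (e , adj) e∈D = ℕ.≤-antisym
    (let e′ , adj′ = ω-Clique G[D] in Clique⇒≤ω G (ι ∘ e′ , adj′))
    (ℕ.≤-trans ωG≤k (Clique⇒≤ω G[D] (ι⁻¹ ∘ e∈D , λ i≢j → ι⁻¹-adj (e∈D _) (e∈D _) (adj i≢j))))

  -- Vertices inside and outside `D` draw on disjoint palettes, so an edge between the two sides is
  -- never monochromatic.
  Colorable-extend : ∀ {m r} → Colorable G[D] m → (κ : Vertex G → Fin r) →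
    (∀ {u v} → ¬ D u → ¬ D v → u ~ v → κ u ≢ κ v) → Colorable G (m + r)
  Colorable-extend {m} {r} (c , proper) κ κ-proper =
    (λ v → join m r (side v (D? v))) ,
    -- `splitAt` recovers the palette from the joined colour; the decisions are passed as arguments
    -- so that `side-proper` can match on them.
    λ u v u~v eq → side-proper u~v (D? u) (D? v)
      (trans (sym (splitAt-join m r _)) (trans (cong (splitAt m) eq) (splitAt-join m r _)))
    where
    side : ∀ v → Dec (D v) → Fin m ⊎ Fin r
    side v (yes d) = inj₁ (c (ι⁻¹ d))
    side v (no _)  = inj₂ (κ v)

    side-proper : ∀ {u v} → u ~ v → ∀ p q → side u p ≢ side v q
    side-proper u~v (yes p) (yes q) = proper _ _ (ι⁻¹-adj p q u~v) ∘ inj₁-injective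
    side-proper u~v (yes _) (no _)  ()
    side-proper u~v (no _)  (yes _) ()
    side-proper u~v (no p)  (no q)  = κ-proper p q u~v ∘ inj₂-injective

  χ≤χG[D]+ : ∀ {r} (κ : Vertex G → Fin r) →
    (∀ {u v} → ¬ D u → ¬ D v → u ~ v → κ u ≢ κ v) → χ G ≤ χ G[D] + r
  χ≤χG[D]+ κ κ-proper = proj₂ (proj₂ (chromaticNumber G)) _
    (Colorable-extend (proj₁ (proj₂ (chromaticNumber G[D]))) κ κ-proper)

-- Edges versus triangles in connected graphs without butterfly or hammer.

module _ (G : Graph) (connected : Connected G)
         (¬butterfly : ¬ butterfly ⊑ G) (¬hammer : ¬ hammer ⊑ G) where
  open Graph G using (_~_; _~?_; symm)

  no-butterfly : ∀ {x a b u v} → x ~ a → x ~ b → a ~ b → x ~ u → x ~ v → u ~ v →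
    ¬ a ~ u → ¬ a ~ v → ¬ b ~ u → ¬ b ~ v → Empty
  no-butterfly {x} {a} {b} {u} {v} xa xb ab xu xv uv ¬au ¬av ¬bu ¬bv =
    ¬butterfly (⊑-fromAgree butterfly G (Vec.lookup (x ∷ a ∷ b ∷ u ∷ v ∷ []))
      (from-yes (twinFree? butterfly))
      ( (xa ∷ xb ∷ xu ∷ xv ∷ []) ∷ (ab ∷ ¬au ∷ ¬av ∷ []) ∷ (¬bu ∷ ¬bv ∷ [])
      ∷ (uv ∷ []) ∷ [] ∷ []))

  no-hammer : ∀ {a b c d e} → a ~ b → a ~ c → b ~ c → c ~ d → d ~ e →
    ¬ a ~ d → ¬ a ~ e → ¬ b ~ d → ¬ b ~ e → ¬ c ~ e → Empty
  no-hammer {a} {b} {c} {d} {e} ab ac bc cd de ¬ad ¬ae ¬bd ¬be ¬ce =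
    ¬hammer (⊑-fromAgree hammer G (Vec.lookup (a ∷ b ∷ c ∷ d ∷ e ∷ []))
      (from-yes (twinFree? hammer))
      ( (ab ∷ ac ∷ ¬ad ∷ ¬ae ∷ []) ∷ (bc ∷ ¬bd ∷ ¬be ∷ []) ∷ (cd ∷ ¬ce ∷ [])
      ∷ (de ∷ []) ∷ [] ∷ []))

  -- If `d` also sees `v`, the triangles `a b d` and `d u v` form a butterfly; if not, the path
  -- `d u v` is the handle of a hammer.
  no-pendantEdge : ∀ {a b d u v} → a ~ b → a ~ d → b ~ d → u ~ v → d ~ u →
    ¬ a ~ u → ¬ a ~ v → ¬ b ~ u → ¬ b ~ v → Empty
  no-pendantEdge {d = d} {v = v} ab ad bd uv du ¬au ¬av ¬bu ¬bv with d ~? v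
  ... | yes dv = no-butterfly (symm ad) (symm bd) ab du dv uv ¬au ¬av ¬bu ¬bv
  ... | no ¬dv = no-hammer ab ad bd du uv ¬au ¬av ¬bu ¬bv ¬dv

  -- Induction along the path from `u` to `a`: the edge slides along it, anticomplete to the
  -- triangle, until the next vertex `d` attaches. A single neighbour of `d` in the triangle starts
  -- the handle of a hammer through `d` and `u`; two neighbours form a triangle with `d`, and `u v`
  -- hangs from it at `d`.
  no-farEdge : ∀ {a b c u v} → a ~ b → a ~ c → b ~ c → u ~ v →
    ¬ a ~ u → ¬ b ~ u → ¬ c ~ u → ¬ a ~ v → ¬ b ~ v → ¬ c ~ v → Star _~_ u a → Empty
  -- The empty path means that `u` is `a`, which `b` does see.
  no-farEdge ab ac bc uv ¬au ¬bu ¬cu ¬av ¬bv ¬cv ε = ¬bu (symm ab)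
  no-farEdge {a} {b} {c} ab ac bc uv ¬au ¬bu ¬cu ¬av ¬bv ¬cv (_◅_ {j = d} ud path)
    with a ~? d | b ~? d | c ~? d
  -- The edge moves one step: `d` takes the place of `u`, and `u` that of `v`.
  ... | no ¬ad | no ¬bd | no ¬cd =
    no-farEdge ab ac bc (symm ud) ¬ad ¬bd ¬cd ¬au ¬bu ¬cu path
  ... | yes ad | no ¬bd | no ¬cd =
    no-hammer bc (symm ab) (symm ac) ad (symm ud) ¬bd ¬bu ¬cd ¬cu ¬au
  ... | no ¬ad | yes bd | no ¬cd =
    no-hammer ac ab (symm bc) bd (symm ud) ¬ad ¬au ¬cd ¬cu ¬bu
  ... | no ¬ad | no ¬bd | yes cd =
    no-hammer ab ac bc cd (symm ud) ¬ad ¬au ¬bd ¬bu ¬cu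
  ... | yes ad | yes bd | _ = no-pendantEdge ab ad bd uv (symm ud) ¬au ¬av ¬bu ¬bv
  ... | yes ad | no _ | yes cd = no-pendantEdge ac ad cd uv (symm ud) ¬au ¬av ¬cu ¬cv
  ... | no _ | yes bd | yes cd = no-pendantEdge bc bd cd uv (symm ud) ¬bu ¬bv ¬cu ¬cv

  -- The third vertex `c` decides: if it sees an end of `u v`, that edge is pendant at `c`;
  -- otherwise connectedness supplies the path for `no-farEdge`.
  triangularEdge-meets : ∀ {a b c u v} → a ~ b → a ~ c → b ~ c → u ~ v →
    ¬ a ~ u → ¬ a ~ v → ¬ b ~ u → ¬ b ~ v → Empty
  triangularEdge-meets {a} {c = c} {u} {v} ab ac bc uv ¬au ¬av ¬bu ¬bv with c ~? u | c ~? v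
  ... | yes cu | _      = no-pendantEdge ab ac bc uv cu ¬au ¬av ¬bu ¬bv
  ... | no _   | yes cv = no-pendantEdge ab ac bc (symm uv) cv ¬av ¬au ¬bv ¬bu
  ... | no ¬cu | no ¬cv = no-farEdge ab ac bc uv ¬au ¬bu ¬cu ¬av ¬bv ¬cv (connected u a)

  -- The vertices sorted by their neighbours in a fixed triangle.

  module _ {a b c} (ab : a ~ b) (ac : a ~ c) (bc : b ~ c) where

    TwoNeighbours : Vertex G → Set
    TwoNeighbours v = (a ~ v × b ~ v) ⊎ (a ~ v × c ~ v) ⊎ (b ~ v × c ~ v)

    twoNeighbours? : U.Decidable TwoNeighbours
    twoNeighbours? v =
      (a ~? v ×-dec b ~? v) ⊎-dec (a ~? v ×-dec c ~? v) ⊎-dec (b ~? v ×-dec c ~? v)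

    -- Any two pairs chosen from the three vertices `a`, `b`, `c` intersect.
    commonNeighbour : ∀ {x y} → TwoNeighbours x → TwoNeighbours y → ∃ λ t → x ~ t × y ~ t
    commonNeighbour (inj₁ (ax , _))        (inj₁ (ay , _))        = a , symm ax , symm ay
    commonNeighbour (inj₁ (ax , _))        (inj₂ (inj₁ (ay , _))) = a , symm ax , symm ay
    commonNeighbour (inj₁ (_ , bx))        (inj₂ (inj₂ (by , _))) = b , symm bx , symm by
    commonNeighbour (inj₂ (inj₁ (ax , _))) (inj₁ (ay , _))        = a , symm ax , symm ay
    commonNeighbour (inj₂ (inj₁ (_ , cx))) (inj₂ (inj₁ (_ , cy))) = c , symm cx , symm cy
    commonNeighbour (inj₂ (inj₁ (_ , cx))) (inj₂ (inj₂ (_ , cy))) = c , symm cx , symm cy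
    commonNeighbour (inj₂ (inj₂ (bx , _))) (inj₁ (_ , by))        = b , symm bx , symm by
    commonNeighbour (inj₂ (inj₂ (_ , cx))) (inj₂ (inj₁ (_ , cy))) = c , symm cx , symm cy
    commonNeighbour (inj₂ (inj₂ (_ , cx))) (inj₂ (inj₂ (_ , cy))) = c , symm cx , symm cy

    open Induced G twoNeighbours?

    G[D]-2K₂-free : ¬ 2K₂ ⊑ G[D]
    G[D]-2K₂-free emb =
      let x , y , u , v , xy , uv , ¬xu , ¬xv , ¬yu , ¬yv = 2K₂-vertices G[D] emb
          -- `t` closes a triangle on the edge `x y` in `G`; adjacency in `G[D]` is adjacency in `G`
          -- by definition.
          t , xt , yt = commonNeighbour (ι-∈ x) (ι-∈ y)
      in triangularEdge-meets xy xt yt uv ¬xu ¬xv ¬yu ¬yv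

    -- The colours stand for `a`, `b`, `c` in this order; each names the triangle vertex opposite to
    -- the missed edge.
    Misses : Vertex G → Fin 3 → Set
    Misses v 0F = ¬ b ~ v × ¬ c ~ v
    Misses v 1F = ¬ a ~ v × ¬ c ~ v
    Misses v 2F = ¬ a ~ v × ¬ b ~ v

    Misses-independent : ∀ {u v} i → Misses u i → Misses v i → ¬ u ~ v
    Misses-independent 0F (¬bu , ¬cu) (¬bv , ¬cv) uv =
      triangularEdge-meets bc (symm ab) (symm ac) uv ¬bu ¬bv ¬cu ¬cv
    Misses-independent 1F (¬au , ¬cu) (¬av , ¬cv) uv =
      triangularEdge-meets ac ab (symm bc) uv ¬au ¬av ¬cu ¬cv
    Misses-independent 2F (¬au , ¬bu) (¬av , ¬bv) uv =
      triangularEdge-meets ab ac bc uv ¬au ¬av ¬bu ¬bv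

    -- Outside `D` at most one of `a`, `b`, `c` is a neighbour, so testing `b` and `c` already finds
    -- a missed edge. On `D` the value is a mere default.
    missed : Vertex G → Fin 3
    missed v = if does (b ~? v) then 1F else if does (c ~? v) then 2F else 0F

    missed-Misses : ∀ {v} → ¬ TwoNeighbours v → Misses v (missed v)
    missed-Misses {v} ¬two with b ~? v | c ~? v
    ... | yes bv | _      = (λ av → ¬two (inj₁ (av , bv))) , λ cv → ¬two (inj₂ (inj₂ (bv , cv)))
    ... | no ¬bv | yes cv = (λ av → ¬two (inj₂ (inj₁ (av , cv)))) , ¬bv
    ... | no ¬bv | no ¬cv = ¬bv , ¬cv

    missed-proper : ∀ {u v} → ¬ TwoNeighbours u → ¬ TwoNeighbours v → u ~ v → missed u ≢ missed v
    missed-proper {u} {v} ¬u ¬v uv eq = Misses-independent (missed v)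
      (subst (Misses u) eq (missed-Misses ¬u)) (missed-Misses ¬v) uv

  -- The triangle consists of the first three clique members: each of them sees the other two, and
  -- every later member sees all three.
  clique-twoNeighbours : ∀ {k} ((e , adj) : Clique G (3 + k)) i →
    TwoNeighbours (adj {0F} {1F} λ ()) (adj {0F} {2F} λ ()) (adj {1F} {2F} λ ()) (e i)
  clique-twoNeighbours (e , adj) 0F                  = inj₂ (inj₂ (adj (λ ()) , adj (λ ())))
  clique-twoNeighbours (e , adj) 1F                  = inj₂ (inj₁ (adj (λ ()) , adj (λ ())))
  clique-twoNeighbours (e , adj) 2F                  = inj₁ (adj (λ ()) , adj (λ ()))
  clique-twoNeighbours (e , adj) (suc (suc (suc i))) = inj₁ (adj (λ ()) , adj (λ ()))

  3≤ω⇒2K₂-free-part : 3 ≤ ω G →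
    ∃ λ G′ → G′ ⊑ G × ¬ 2K₂ ⊑ G′ × ω G′ ≡ ω G × χ G ≤ χ G′ + 3
  3≤ω⇒2K₂-free-part 3≤ω =
    -- Writing `ω G` as `3 + k` exposes the three indices that give the triangle in a maximum
    -- clique.
    let k , 3+k≡ω = ℕ.m≤n⇒∃[o]m+o≡n 3≤ω
    in part (ℕ.≤-reflexive (sym 3+k≡ω)) (subst (Clique G) (sym 3+k≡ω) (ω-Clique G))
    where
    part : ∀ {k} → ω G ≤ 3 + k → Clique G (3 + k) →
      ∃ λ G′ → G′ ⊑ G × ¬ 2K₂ ⊑ G′ × ω G′ ≡ ω G × χ G ≤ χ G′ + 3
    part ω≤3+k K@(_ , adj) =
      G[D] , G[D]⊑G , G[D]-2K₂-free ab ac bc , ωG[D]≡ωG ω≤3+k K (clique-twoNeighbours K) ,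
      χ≤χG[D]+ (missed ab ac bc) (missed-proper ab ac bc)
      where
      ab = adj {0F} {1F} λ ()
      ac = adj {0F} {2F} λ ()
      bc = adj {1F} {2F} λ ()
      open Induced G (twoNeighbours? ab ac bc)

-- The bound, by cases on the clique number.

ω≤1⇒2K₂-free : ∀ G → ω G ≤ 1 → ¬ 2K₂ ⊑ G
ω≤1⇒2K₂-free G ω≤1 emb =
  let _ , _ , _ , _ , xy , _ = 2K₂-vertices G emb
  in ℕ.<⇒≱ (edge⇒2≤ω G xy) ω≤1

corollary3p3 : (H : Graph) (f : ℕ → ℕ) →
    (∀ G′ → (2K₂ ∷ H ∷ []) -Free G′ → χ G′ ≤ f (ω G′)) →
    ∀ G → Connected G → (butterfly ∷ hammer ∷ H ∷ []) -Free G → ω G ≢ 2 →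
    χ G ≤ f (ω G) + 3
corollary3p3 H f χ-bound G connected (¬butterfly ∷ ¬hammer ∷ ¬H ∷ []) ω≢2 =
  -- For `ω G ≤ 1` the given bound applies to `G` itself; otherwise `ω G ≢ 2` leaves only `3 ≤ ω G`.
  [ sparse , dense ]′ (ℕ.≤-<-connex (ω G) 1)
  where
  open ℕ.≤-Reasoning

  sparse : ω G ≤ 1 → χ G ≤ f (ω G) + 3
  sparse ω≤1 = ℕ.m≤n⇒m≤n+o 3 (χ-bound G (ω≤1⇒2K₂-free G ω≤1 ∷ ¬H ∷ []))

  dense : 2 ≤ ω G → χ G ≤ f (ω G) + 3
  dense 2≤ω =
    let G′ , G′⊑G , ¬2K₂ , ω≡ , χ≤ =
          3≤ω⇒2K₂-free-part G connected ¬butterfly ¬hammer (ℕ.≤∧≢⇒< 2≤ω (ω≢2 ∘ sym))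
        ¬H′ = λ H⊑G′ → ¬H (⊑-trans {H} {G′} {G} H⊑G′ G′⊑G)
    in begin
      χ G           ≤⟨ χ≤ ⟩
      χ G′ + 3      ≤⟨ ℕ.+-monoˡ-≤ 3 (χ-bound G′ (¬2K₂ ∷ ¬H′ ∷ [])) ⟩
      f (ω G′) + 3  ≡⟨ cong (λ w → f w + 3) ω≡ ⟩
      f (ω G) + 3   ∎
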